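{- Let $B=B_\Gamma$ be the skew-symmetric matrix of an ideal triangulation $\Gamma$ of a once-punctured surface $(S,P)$. Then $B$ does not have reddening or maximal green sequences; that is, no mutation sequence of the form $(B,m,\sigma)$ is reddening, and none is maximal green.
   Context: Surfaces. $S$ is a closed oriented surface and $P$ is a one-point subset of $S$ (the puncture); $(S,P)$ is then called a once-punctured surface. An ideal triangulation $\Gamma$ of $(S,P)$ is a triangulation of $S$ (in the generalized sense: edges may be loops and triangles may have identified vertices or share several edges) whose vertices are the points of $P$; it is assumed to have no self-folded edges, i.e. no triangle has two of its sides glued to each other to enclose a puncture (this holds for every ideal triangulation of a once-punctured closed surface). Label the edges of $\Gamma$ by $1,\dots,n$. For a triangle $t$ of $\Gamma$ let $B^t$ be the $n\times n$ matrix with $B^t_{ij}=1$ if $t$ has sides $i$ and $j$ and the direction from $i$ to $j$ is clockwise, $B^t_{ij}=-1$ if the same holds with counter-clockwise, and $B^t_{ij}=0$ otherwise. Put $B_\Gamma=\sum_t B^t$, the sum over all triangles $t$ of $\Gamma$; it is a skew-symmetric integer matrix. Mutations of matrices. For a skew-symmetric $n\times n$ integer matrix $B$ and $k\in\{1,\dots,n\}$, $\mu_k(B)=\widetilde B$ where $\widetilde B_{ij}=-B_{ij}$ if $i=k$ or $j=k$; otherwise $\widetilde B_{ij}=B_{ij}+B_{ik}B_{kj}$ if $B_{ik}>0$ and $B_{kj}>0$, $\widetilde B_{ij}=B_{ij}-B_{ik}B_{kj}$ if $B_{ik}<0$ and $B_{kj}<0$, and $\widetilde B_{ij}=B_{ij}$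 in the remaining cases. Tropical Y-seeds. Let $\mathcal F_{\mathrm{trop}}$ be the set of Laurent monomials in $y_1,\dots,y_n$ with the usual multiplication and the addition $\prod_i y_i^{a_i}\oplus\prod_i y_i^{b_i}=\prod_i y_i^{\min(a_i,b_i)}$. For $Y\in\mathcal F_{\mathrm{trop}}^n$, the mutation is $\mu_k(B,Y)=(\mu_k(B),\widetilde Y)$ with $\widetilde Y_k=Y_k^{ -1}$ and, for $i\ne k$, $\widetilde Y_i=Y_i(Y_k^{ -1}\oplus1)^{ -B_{ki}}$ if $B_{ki}\ge0$ and $\widetilde Y_i=Y_i(Y_k\oplus1)^{ -B_{ki}}$ if $B_{ki}\le0$. A permutation $\sigma$ acts by $\sigma(B)_{ij}=B_{\sigma^{ -1}(i)\sigma^{ -1}(j)}$, $\sigma(Y)_i=Y_{\sigma^{ -1}(i)}$. A mutation sequence is a triple $\gamma=(B,m,\sigma)$ with $m=(m_1,\dots,m_T)$ a sequence in $\{1,\dots,n\}$ and $\sigma=(\sigma_1,\dots,\sigma_T)$ a sequence of permutations of $\{1,\dots,n\}$. Put $(B(0),Y(0))=(B,(y_1,\dots,y_n))$ and $(B(t),Y(t))=\sigma_t(\mu_{m_t}(B(t-1),Y(t-1)))$ for $1\le t\le T$, computed in $\mathcal F_{\mathrm{trop}}$. Define integers $c_{ij}(t)$ by $Y_j(t)=y_1^{c_{1j}(t)}\cdots y_n^{c_{nj}(t)}$; the $C$-matrix is $C(t)=(c_{ij}(t))_{1\le i,j\le n}$ and its columns $\mathbf c_j(t)$ are the $\mathbf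 c$-vectors. By the known sign-coherence theorem, each $\mathbf c_j(t)$ is non-zero with entries either all non-negative or all non-positive; let $\varepsilon_t\in\{+,-\}$ be the sign of $\mathbf c_{m_t}(t-1)$. The mutation sequence $\gamma$ is reddening if all entries of $C(T)$ are non-positive, and maximal green if it is reddening and $\varepsilon_t=+$ for all $t=1,\dots,T$. -}

module Defs where

open import Algebra.Definitions.RawMonoid using (sum)
open import Data.Bool using (if_then_else_)
open import Data.Fin using (Fin; zero; suc; fromℕ; inject₁; _≟_)
open import Data.Fin.Patterns using (0F; 1F; 2F)
open import Data.Fin.Permutation using (Permutation′; _⟨$⟩ˡ_)
open import Data.Fin.Properties using (any?)
open import Data.Integer using (ℤ; 0ℤ; 1ℤ; -1ℤ; _+_; _-_; _*_; -_; _⊓_; _≤_; _≤?_; _<?_; +-0-rawMonoid)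
open import Data.Nat using (ℕ; suc)
open import Data.Product using (∃; _×_; _,_; proj₂)
open import Data.Sign using (Sign)
open import Data.Sum using (_⊎_)
open import Data.Vec using (Vec; []; _∷_; lookup)
open import Relation.Binary.Construct.Closure.Equivalence using (EqClosure)
open import Relation.Binary.PropositionalEquality using (_≡_; _≢_)
open import Relation.Nullary using (Dec; does)
open import Relation.Nullary.Decidable using (_×-dec_; _⊎-dec_)

-- A side of one of N disjoint oriented triangles: the triangle and the
-- position of the side in it.  The sides at positions 0, 1, 2 follow each
-- other in clockwise order.
Side : ℕ → Set
Side N = Fin N × Fin 3

next : Fin 3 → Fin 3
next 0F = 1F
next 1F = 2F
next 2F = 0F

nextSide : ∀ {N} → Side N → Side N
nextSide (t , p) = t , next p

-- A triangulated closed oriented surface, without self-folded edges and with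
-- edges labelled by Fin n.  The surface is the quotient of N disjoint
-- clockwise oriented triangles in which each side s is glued to the side
-- glue s with the opposite direction, so that the orientations of the
-- triangles agree.  The edges are the pairs {s, glue s}, and `edge` is a
-- bijective labelling of them.
record IdealTriangulation (n : ℕ) : Set where
  field
    N               : ℕ
    glue            : Side N → Side N
    glue-involutive : ∀ s → glue (glue s) ≡ s
    glue-other      : ∀ s → glue s ≢ s
    no-self-folded  : ∀ t {p q} → p ≢ q → glue (t , p) ≢ (t , q)
    edge            : Side N → Fin n
    edge-glue       : ∀ s → edge (glue s) ≡ edge s
    edge-injective  : ∀ {s s′} → edge s ≡ edge s′ → s′ ≡ s ⊎ s′ ≡ glue s
    edge-surjective : ∀ e → ∃ λ s → edge s ≡ e

module _ {n : ℕ} (Γ : IdealTriangulation n) where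
  open IdealTriangulation Γ

  -- A side s, traversed clockwise, also stands for the corner of its triangle
  -- at which it starts.  As glued sides have opposite directions, the start
  -- of s is identified with the end of glue s, which is the start of the side
  -- following glue s.
  CornerStep : Side N → Side N → Set
  CornerStep s s′ = s′ ≡ nextSide (glue s)

  -- The vertices of the triangulation are the classes of this relation.
  SameVertex : Side N → Side N → Set
  SameVertex = EqClosure CornerStep

  -- There is exactly one vertex.  In particular the surface is connected,
  -- since every component contains a vertex.
  OncePunctured : Set
  OncePunctured = Side N × (∀ s s′ → SameVertex s s′)

Matrix : ℕ → Set
Matrix n = Fin n → Fin n → ℤ

module _ {n : ℕ} (Γ : IdealTriangulation n) where
  open IdealTriangulation Γ

  Clockwise : Fin N → Fin n → Fin n → Set
  Clockwise t i j = ∃ λ p → edge (t , p) ≡ i × edge (t , next p) ≡ j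

  clockwise? : ∀ t i j → Dec (Clockwise t i j)
  clockwise? t i j = any? λ p → (edge (t , p) ≟ i) ×-dec (edge (t , next p) ≟ j)

  -- No edge is self-folded, so Clockwise t i j and Clockwise t j i exclude
  -- each other.
  triangleMatrix : Fin N → Matrix n
  triangleMatrix t i j =
    if does (clockwise? t i j) then 1ℤ else
    if does (clockwise? t j i) then -1ℤ else
    0ℤ

  adjacencyMatrix : Matrix n
  adjacencyMatrix i j = sum +-0-rawMonoid λ t → triangleMatrix t i j

mutateMatrix : ∀ {n} → Fin n → Matrix n → Matrix n
mutateMatrix k B i j =
  if does ((i ≟ k) ⊎-dec (j ≟ k)) then - B i j else
  if does ((0ℤ <? B i k) ×-dec (0ℤ <? B k j)) then B i j + B i k * B k j else
  if does ((B i k <? 0ℤ) ×-dec (B k j <? 0ℤ)) then B i j - B i k * B k j else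
  B i j

permuteMatrix : ∀ {n} → Permutation′ n → Matrix n → Matrix n
permuteMatrix σ B i j = B (σ ⟨$⟩ˡ i) (σ ⟨$⟩ˡ j)

-- The Laurent monomial y₁^a₁ ⋯ yₙ^aₙ is given by its exponents a.
Trop : ℕ → Set
Trop n = Fin n → ℤ

infixl 6 _⊕_
infixl 7 _⊗_
infixr 8 _^_

one : ∀ {n} → Trop n
one _ = 0ℤ

_⊗_ : ∀ {n} → Trop n → Trop n → Trop n
(a ⊗ b) i = a i + b i

_⊕_ : ∀ {n} → Trop n → Trop n → Trop n
(a ⊕ b) i = a i ⊓ b i

_^_ : ∀ {n} → Trop n → ℤ → Trop n
(a ^ z) i = z * a i

var : ∀ {n} → Fin n → Trop n
var j i = if does (i ≟ j) then 1ℤ else 0ℤ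

Coefficients : ℕ → Set
Coefficients n = Fin n → Trop n

mutateCoefficients : ∀ {n} → Fin n → Matrix n → Coefficients n → Coefficients n
mutateCoefficients k B Y i =
  if does (i ≟ k) then Y k ^ -1ℤ else
  if does (0ℤ ≤? B k i) then Y i ⊗ (Y k ^ -1ℤ ⊕ one) ^ (- B k i) else
  Y i ⊗ (Y k ⊕ one) ^ (- B k i)

Seed : ℕ → Set
Seed n = Matrix n × Coefficients n

mutate : ∀ {n} → Fin n → Seed n → Seed n
mutate k (B , Y) = mutateMatrix k B , mutateCoefficients k B Y

permute : ∀ {n} → Permutation′ n → Seed n → Seed n
permute σ (B , Y) = permuteMatrix σ B , λ i → Y (σ ⟨$⟩ˡ i)

record MutationSequence {n : ℕ} (B : Matrix n) : Set where
  field
    T : ℕ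
    m : Vec (Fin n) T
    σ : Vec (Permutation′ n) T

-- (B(t), Y(t)), the seed reached after the first t steps.
seedAfter : ∀ {n T} → Seed n → Vec (Fin n) T → Vec (Permutation′ n) T → Fin (suc T) → Seed n
seedAfter s _       _       zero    = s
seedAfter s (k ∷ m) (π ∷ σ) (suc t) = seedAfter (permute π (mutate k s)) m σ t

data HasSign {n : ℕ} : Sign → (Fin n → ℤ) → Set where
  positive : ∀ {c} → (∃ λ i → c i ≢ 0ℤ) → (∀ i → 0ℤ ≤ c i) → HasSign Sign.+ c
  negative : ∀ {c} → (∃ λ i → c i ≢ 0ℤ) → (∀ i → c i ≤ 0ℤ) → HasSign Sign.- c

module _ {n : ℕ} {B : Matrix n} (γ : MutationSequence B) where
  open MutationSequence γ

  seed : Fin (suc T) → Seed n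
  seed = seedAfter (B , var) m σ

  cMatrix : Fin (suc T) → Matrix n
  cMatrix t i j = proj₂ (seed t) j i

  cVector : Fin (suc T) → Fin n → (Fin n → ℤ)
  cVector t j i = cMatrix t i j

  -- An index t : Fin T, counted from 0, stands for the step from seed t to
  -- seed (t + 1), in direction lookup m t.
  StepSign : Fin T → Sign → Set
  StepSign t ε = HasSign ε (cVector (inject₁ t) (lookup m t))

  Reddening : Set
  Reddening = ∀ i j → cMatrix (fromℕ T) i j ≤ 0ℤ

  MaximalGreen : Set
  MaximalGreen = Reddening × (∀ t → StepSign t Sign.+)

{-# OPTIONS --safe #-}
-- The product of all Y_j(t) is invariant under mutation at k as soon as row k
-- of B(t) has positive and negative parts with sum 2: the factors contributed
-- by the arrows at k are (Y_k⁻¹ ⊕ 1)⁻² (Y_k ⊕ 1)², which is Y_k², against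
-- Y_k⁻¹ in place of Y_k.  So the c-vectors always add up to (1, …, 1), and
-- cannot all be non-positive.  The rows are as required because each B(t) comes
-- from a triangulation with one vertex: mutations are flips, each edge has two
-- outgoing and two incoming arrows, and these do not cancel, since arrows
-- i → j → i would need a vertex with only two edge ends.
module Submission where

open import Defs
open import Data.Nat using (ℕ; _+_; _*_)
open import Data.Product using (∃; _×_; _,_; proj₁; proj₂)
open import Relation.Nullary using (¬_; Dec; yes; no; does; contradiction)

open import Data.Bool as Bool using (Bool; true; false; not; if_then_else_)
open import Data.Bool.Properties using (not-involutive; ¬-not)
open import Data.Fin as Fin using (Fin; zero; suc; fromℕ)
open import Data.Fin.Patterns using (0F; 1F; 2F)
open import Data.Fin.Permutation as Perm using (Permutation′; _⟨$⟩ˡ_; _⟨$⟩ʳ_)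
open import Data.Fin.Properties using (any?)
open import Data.Integer as ℤ using (ℤ; +_; -[1+_]; 0ℤ; 1ℤ; -1ℤ; _-_; -_; _⊓_)
import Data.Integer.Properties as ℤ
import Data.Integer.Tactic.RingSolver as ℤ
import Data.Nat as ℕ
open import Data.Nat.Properties using (*-distribʳ-+; +-comm; +-identityʳ; *-zeroʳ)
open import Data.Nat.Tactic.RingSolver using (solve-∀)
open import Data.Product.Properties using (≡-dec)
open import Data.Sum using (_⊎_; inj₁; inj₂; [_,_]′)
open import Data.Vec using (Vec; []; _∷_)
open import Function using (_∘_)
open import Function.Bundles using (mk⇔)
open import Relation.Binary using (DecidableEquality)
open import Relation.Binary.Construct.Closure.Equivalence using (gfold)
open import Relation.Binary.PropositionalEquality
open import Relation.Nullary.Decidable using (dec-true; dec-false; does-⇔; map′; _×-dec_; _⊎-dec_)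

open import Algebra.Properties.CommutativeMonoid.Sum ℤ.+-0-commutativeMonoid
  using (sum; sum-cong-≗; ∑-distrib-+; sum-permute; sum-replicate-zero)

-- Indicators and finite sums of integers

indicator : ∀ {p} {P : Set p} → Dec P → ℕ
indicator P? = if does P? then 1 else 0

module _ {p} {P : Set p} where

  indicator-true : (P? : Dec P) → P → indicator P? ≡ 1
  indicator-true P? p = cong (if_then 1 else 0) (dec-true P? p)

  indicator-false : (P? : Dec P) → ¬ P → indicator P? ≡ 0
  indicator-false P? ¬p = cong (if_then 1 else 0) (dec-false P? ¬p)

  indicator-⇔ : ∀ {q} {Q : Set q} → (P → Q) → (Q → P) →
    (P? : Dec P) (Q? : Dec Q) → indicator P? ≡ indicator Q?
  indicator-⇔ to from P? Q? = cong (if_then 1 else 0) (does-⇔ (mk⇔ to from) P? Q?)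

sum-point : ∀ {n} (x : Fin n) c → sum (λ i → + indicator (x Fin.≟ i) ℤ.* c) ≡ c
sum-point {ℕ.suc n} zero c = begin
  1ℤ ℤ.* c ℤ.+ sum {n} (λ _ → 0ℤ) ≡⟨ cong₂ ℤ._+_ (ℤ.*-identityˡ c) (sum-replicate-zero n) ⟩
  c ℤ.+ 0ℤ                        ≡⟨ ℤ.+-identityʳ c ⟩
  c                               ∎
  where open ≡-Reasoning
sum-point (suc x) c = trans (ℤ.+-identityˡ _) (sum-point x c)

sum-update : ∀ {n} (f : Fin n → ℤ) x c → sum (λ i → f i ℤ.+ + indicator (x Fin.≟ i) ℤ.* c) ≡ sum f ℤ.+ c
sum-update f x c = trans (∑-distrib-+ f _) (cong (λ z → sum f ℤ.+ z) (sum-point x c))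

sum-nonpositive : ∀ {n} (f : Fin n → ℤ) → (∀ i → f i ℤ.≤ 0ℤ) → sum f ℤ.≤ 0ℤ
sum-nonpositive {ℕ.zero}  f f≤0 = ℤ.≤-refl
sum-nonpositive {ℕ.suc n} f f≤0 = ℤ.+-mono-≤ (f≤0 zero) (sum-nonpositive (f ∘ suc) (f≤0 ∘ suc))

-- The mutation rules in terms of positive and negative parts

-- The branches of `mutateMatrix` for i, j ≠ k, as a function of the integers B i j, B i k and B k
-- j, so that cases can be distinguished on natural numbers.
mutateEntry : ℤ → ℤ → ℤ → ℤ
mutateEntry z x y =
  if does ((0ℤ ℤ.<? x) ×-dec (0ℤ ℤ.<? y)) then z ℤ.+ x ℤ.* y else
  if does ((x ℤ.<? 0ℤ) ×-dec (y ℤ.<? 0ℤ)) then z - x ℤ.* y else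
  z

-- As one of p, q and one of r, s vanish, these numbers are the positive and negative parts of x and
-- y. The branches then merge into z + x⁺y⁺ - x⁻y⁻.
mutateEntry-parts : ∀ z p q r s → p ≡ 0 ⊎ q ≡ 0 → r ≡ 0 ⊎ s ≡ 0 →
  mutateEntry z (+ p - + q) (+ r - + s) ≡ z ℤ.+ (+ (p * r) - + (q * s))
mutateEntry-parts z 0 0 r s _ _ = sym (ℤ.+-identityʳ z)
mutateEntry-parts z 0 (ℕ.suc q) 0 0 _ _ rewrite *-zeroʳ q = sym (ℤ.+-identityʳ z)
mutateEntry-parts z 0 (ℕ.suc q) 0 (ℕ.suc s) _ _ = cong (λ x → z ℤ.+ x) (sym (ℤ.+-identityˡ (- (+ (ℕ.suc q * ℕ.suc s)))))
mutateEntry-parts z 0 (ℕ.suc q) (ℕ.suc r) 0 _ _ rewrite *-zeroʳ q = sym (ℤ.+-identityʳ z)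
mutateEntry-parts z (ℕ.suc p) 0 0 0 _ _ rewrite *-zeroʳ p = sym (ℤ.+-identityʳ z)
mutateEntry-parts z (ℕ.suc p) 0 0 (ℕ.suc s) _ _ rewrite *-zeroʳ p = sym (ℤ.+-identityʳ z)
mutateEntry-parts z (ℕ.suc p) 0 (ℕ.suc r) 0 _ _
  rewrite +-identityʳ p | +-identityʳ r | +-identityʳ (r + p * ℕ.suc r) = refl
mutateEntry-parts z (ℕ.suc p) (ℕ.suc q) r s (inj₁ ()) _
mutateEntry-parts z (ℕ.suc p) (ℕ.suc q) r s (inj₂ ()) _
mutateEntry-parts z 0 (ℕ.suc q) (ℕ.suc r) (ℕ.suc s) _ (inj₁ ())
mutateEntry-parts z 0 (ℕ.suc q) (ℕ.suc r) (ℕ.suc s) _ (inj₂ ())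
mutateEntry-parts z (ℕ.suc p) 0 (ℕ.suc r) (ℕ.suc s) _ (inj₁ ())
mutateEntry-parts z (ℕ.suc p) 0 (ℕ.suc r) (ℕ.suc s) _ (inj₂ ())

coefficientFactor : ℤ → ℤ → ℤ → ℤ
coefficientFactor z b y = if does (0ℤ ℤ.≤? b) then z ℤ.+ (- b) ℤ.* (-1ℤ ℤ.* y ⊓ 0ℤ) else z ℤ.+ (- b) ℤ.* (y ⊓ 0ℤ)

-- A positive entry p picks the factor (Y_k⁻¹ ⊕ 1)⁻ᵖ and a negative one -q picks (Y_k ⊕ 1)^q. With p
-- or q zero, the other factor can be written along as trivial, which removes the case distinction
-- on the sign.
coefficientFactor-parts : ∀ z p q y → p ≡ 0 ⊎ q ≡ 0 →
  coefficientFactor z (+ p - + q) y ≡ (z ℤ.+ + p ℤ.* (- (-1ℤ ℤ.* y ⊓ 0ℤ))) ℤ.+ + q ℤ.* (y ⊓ 0ℤ)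
coefficientFactor-parts z p 0 y _ rewrite +-identityʳ p = at-source z (+ p) (-1ℤ ℤ.* y ⊓ 0ℤ) (y ⊓ 0ℤ)
  where
  at-source : ∀ z p u v → z ℤ.+ (- p) ℤ.* u ≡ (z ℤ.+ p ℤ.* (- u)) ℤ.+ 0ℤ ℤ.* v
  at-source = ℤ.solve-∀
coefficientFactor-parts z 0 (ℕ.suc q) y _ = at-target z (+ ℕ.suc q) (-1ℤ ℤ.* y ⊓ 0ℤ) (y ⊓ 0ℤ)
  where
  at-target : ∀ z q u v → z ℤ.+ q ℤ.* v ≡ (z ℤ.+ 0ℤ ℤ.* (- u)) ℤ.+ q ℤ.* v
  at-target = ℤ.solve-∀
coefficientFactor-parts z (ℕ.suc p) (ℕ.suc q) y (inj₁ ())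
coefficientFactor-parts z (ℕ.suc p) (ℕ.suc q) y (inj₂ ())

-- Tropically this is Y_k ⊕ 1 = Y_k (Y_k⁻¹ ⊕ 1).
min-difference : ∀ y → y ⊓ 0ℤ ≡ y ℤ.+ (-1ℤ ℤ.* y ⊓ 0ℤ)
min-difference (+ 0)        = refl
min-difference (+ ℕ.suc n)  = sym (trans (cong (λ m → + ℕ.suc n ℤ.+ -[1+ m ]) (+-identityʳ n)) (ℤ.+-inverseʳ (+ ℕ.suc n)))
min-difference (-[1+ n ])   = sym (ℤ.+-identityʳ _)

-- One-vertex triangulations on a fixed set of glued sides

module Triangulations {H : Set} (_≟ᴴ_ : DecidableEquality H)
  (glue : H → H) (glue-involutive : ∀ h → glue (glue h) ≡ h) (glue-other : ∀ h → glue h ≢ h) where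

  -- The elements of H are the sides of the triangles, as in IdealTriangulation;
  -- only the triangles, which are the cycles of succ, and the labels vary.
  -- CornerStep is succ ∘ glue, so one-vertex says that it has a single orbit.
  record Triangulation (n : ℕ) : Set where
    field
      edge           : H → Fin n
      edge-glue      : ∀ h → edge (glue h) ≡ edge h
      edge-injective : ∀ {h h′} → edge h ≡ edge h′ → h′ ≡ h ⊎ h′ ≡ glue h
      side           : Fin n → H
      edge-side      : ∀ i → edge (side i) ≡ i
      succ           : H → H
      succ³          : ∀ h → succ (succ (succ h)) ≡ h
      succ-other     : ∀ h → succ h ≢ h
      one-vertex     : ∀ (f : H → Bool) → (∀ h → f (succ h) ≡ f (glue h)) → ∀ h h′ → f h ≡ f h′

  -- Arrows between the edges of a triangulation

  module Arrows {n} (Δ : Triangulation n) where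
    open Triangulation Δ

    succ-injective : ∀ {h h′} → succ h ≡ succ h′ → h ≡ h′
    succ-injective {h} {h′} e = trans (sym (succ³ h)) (trans (cong (succ ∘ succ) e) (succ³ h′))

    pred≡ : ∀ {h h′} → succ h ≡ h′ → h ≡ succ (succ h′)
    pred≡ {h} refl = sym (succ³ h)

    -- Otherwise {glue h, g} would be a vertex, hence contain h.
    vertex-not-bivalent : ∀ {h g} → succ h ≡ g → succ (glue g) ≢ glue h
    vertex-not-bivalent {h} {g} h→g g→h = false≢true (trans (sym (at-h)) (trans (one-vertex f invariant h g) at-g))
      where
      member? : ∀ x → Dec (x ≡ glue h ⊎ x ≡ g)
      member? x = (x ≟ᴴ glue h) ⊎-dec (x ≟ᴴ g)

      f : H → Bool
      f x = does (member? x)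

      invariant : ∀ x → f (succ x) ≡ f (glue x)
      invariant x = does-⇔ (mk⇔ to from) (member? (succ x)) (member? (glue x))
        where
        to : succ x ≡ glue h ⊎ succ x ≡ g → glue x ≡ glue h ⊎ glue x ≡ g
        to (inj₁ e) = inj₂ (trans (cong glue (succ-injective (trans e (sym g→h)))) (glue-involutive g))
        to (inj₂ e) = inj₁ (cong glue (succ-injective (trans e (sym h→g))))

        from : glue x ≡ glue h ⊎ glue x ≡ g → succ x ≡ glue h ⊎ succ x ≡ g
        from (inj₁ e) = inj₂ (trans (cong succ x≡h) h→g)
          where x≡h = trans (sym (glue-involutive x)) (trans (cong glue e) (glue-involutive h))
        from (inj₂ e) = inj₁ (trans (cong succ (trans (sym (glue-involutive x)) (cong glue e))) g→h)

      false≢true : false ≢ true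
      false≢true ()

      at-g : f g ≡ true
      at-g = dec-true (member? g) (inj₂ refl)

      at-h : f h ≡ false
      at-h = dec-false (member? h) λ where
        (inj₁ e) → glue-other h (sym e)
        (inj₂ e) → succ-other h (trans h→g (sym e))

    -- A self-folded side is the degenerate case g = `glue h` of a bivalent vertex: the start of
    -- `glue h` would be the only edge end there. As this follows from `one-vertex`, it persists
    -- under flips.
    succ≢glue : ∀ h → succ h ≢ glue h
    succ≢glue h e = vertex-not-bivalent e (trans (cong succ (glue-involutive h)) e)

    -- The two sides of an edge exhaust it by `edge-injective` and differ by `glue-other`. The
    -- counting form allows the sides of two edges to be double counted.
    incidence : ∀ i h → indicator (side i ≟ᴴ h) + indicator (glue (side i) ≟ᴴ h) ≡ indicator (edge h Fin.≟ i)
    incidence i h with edge h Fin.≟ i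
    ... | no e≢i = cong₂ _+_
            (indicator-false (side i ≟ᴴ h) λ { refl → e≢i (edge-side i) })
            (indicator-false (glue (side i) ≟ᴴ h) λ { refl → e≢i (trans (edge-glue _) (edge-side i)) })
    ... | yes refl with edge-injective (edge-side (edge h))
    ...   | inj₁ h≡s = cong₂ _+_
              (indicator-true (side _ ≟ᴴ h) (sym h≡s))
              (indicator-false (glue (side _) ≟ᴴ h) λ e → glue-other _ (trans e h≡s))
    ...   | inj₂ h≡s = cong₂ _+_
              (indicator-false (side _ ≟ᴴ h) λ e → glue-other _ (sym (trans e h≡s)))
              (indicator-true (glue (side _) ≟ᴴ h) (sym h≡s))

    meets : H → Fin n → ℕ
    meets h j = indicator (edge h Fin.≟ j)

    -- Arrows before any cancellation: each of the two sides of i sends one arrow to the edge that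
    -- follows it clockwise.
    arrows : Fin n → Fin n → ℕ
    arrows i j = meets (succ (side i)) j + meets (succ (glue (side i))) j

    -- Double counting: an arrow from i to k is a side of i whose successor is a side of k, and can
    -- equally be found from its end, `succ ∘ succ` being the inverse of `succ`.
    arrows-into : ∀ i k → arrows i k ≡ meets (succ (succ (side k))) i + meets (succ (succ (glue (side k)))) i
    arrows-into i k = begin
      arrows i k
        ≡⟨ cong₂ _+_ (ends (side i)) (ends (glue (side i))) ⟩
      _
        ≡⟨ swap-middle (δ (side i) a) _ _ _ ⟩
      (δ (side i) a + δ (glue (side i)) a) + (δ (side i) b + δ (glue (side i)) b)
        ≡⟨ cong₂ _+_ (incidence i a) (incidence i b) ⟩
      meets a i + meets b i ∎
      where
      open ≡-Reasoning
      a b : H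
      a = succ (succ (side k))
      b = succ (succ (glue (side k)))

      δ : H → H → ℕ
      δ h g = indicator (h ≟ᴴ g)

      swap-middle : ∀ w x y z → (w + x) + (y + z) ≡ (w + y) + (x + z)
      swap-middle = solve-∀

      before : ∀ h g → δ g (succ h) ≡ δ h (succ (succ g))
      before h g = indicator-⇔ (λ e → pred≡ (sym e)) (λ { refl → sym (succ³ g) }) (g ≟ᴴ succ h) (h ≟ᴴ succ (succ g))

      ends : ∀ h → meets (succ h) k ≡ δ h a + δ h b
      ends h = trans (sym (incidence k (succ h))) (cong₂ _+_ (before h _) (before h _))

    edge-succ≢ : ∀ h → edge (succ h) ≢ edge h
    edge-succ≢ h e = [ succ-other h , succ≢glue h ]′ (edge-injective (sym e))

    no-loop : ∀ i → arrows i i ≡ 0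
    no-loop i = cong₂ _+_
      (indicator-false (edge (succ (side i)) Fin.≟ i) λ e → edge-succ≢ _ (trans e (sym (edge-side i))))
      (indicator-false (edge (succ (glue (side i))) Fin.≟ i) λ e →
        edge-succ≢ _ (trans e (sym (trans (edge-glue _) (edge-side i)))))

    -- Each of the two edges is met again in the same side or in the opposite one. Twice the same
    -- side contradicts the period 3 of `succ`, one opposite side gives a self-folded edge, and two
    -- opposite sides give a bivalent vertex.
    no-return : ∀ {h g} → edge g ≡ edge (succ h) → edge (succ g) ≢ edge h
    no-return {h} {g} e e′ with edge-injective (sym e) | edge-injective (sym e′)
    ... | inj₁ refl | inj₁ q = succ-other h (trans (cong succ (sym q)) (succ³ h))
    ... | inj₁ refl | inj₂ q = succ≢glue (glue h) (trans (trans (cong succ (sym q)) (succ³ h)) (sym (glue-involutive h)))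
    ... | inj₂ refl | inj₁ q = succ≢glue (succ h) (sym (pred≡ q))
    ... | inj₂ refl | inj₂ q = vertex-not-bivalent refl q

    no-arrow-back : ∀ {h i j} → edge h ≡ i → edge (succ h) ≡ j → arrows j i ≡ 0
    no-arrow-back {i = i} refl refl = cong₂ _+_
      (indicator-false (edge (succ (side _)) Fin.≟ i) (no-return (edge-side _)))
      (indicator-false (edge (succ (glue (side _))) Fin.≟ i) (no-return (trans (edge-glue _) (edge-side _))))

    -- This makes `arrows i j` and `arrows j i` the positive and negative parts of the matrix entry,
    -- as the mutation rules require.
    no-2-cycle : ∀ i j → arrows i j ≡ 0 ⊎ arrows j i ≡ 0
    no-2-cycle i j with edge (succ (side i)) Fin.≟ j | edge (succ (glue (side i))) Fin.≟ j
    ... | no _  | no _  = inj₁ refl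
    ... | yes e | _     = inj₂ (no-arrow-back (edge-side i) e)
    ... | no _  | yes e = inj₂ (no-arrow-back (trans (edge-glue _) (edge-side i)) e)

  -- Relabelling of edges

  permuteEdges : ∀ {n} → Permutation′ n → Triangulation n → Triangulation n
  permuteEdges π Δ = record
    { edge           = λ h → π ⟨$⟩ʳ edge h
    ; edge-glue      = λ h → cong (π ⟨$⟩ʳ_) (edge-glue h)
    ; edge-injective = λ e → edge-injective
        (trans (sym (Perm.inverseˡ π)) (trans (cong (π ⟨$⟩ˡ_) e) (Perm.inverseˡ π)))
    ; side           = λ i → side (π ⟨$⟩ˡ i)
    ; edge-side      = λ i → trans (cong (π ⟨$⟩ʳ_) (edge-side _)) (Perm.inverseʳ π)
    ; succ           = succ
    ; succ³          = succ³
    ; succ-other     = succ-other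
    ; one-vertex     = one-vertex
    }
    where open Triangulation Δ

  arrows-permute : ∀ {n} (π : Permutation′ n) Δ i j →
    Arrows.arrows (permuteEdges π Δ) i j ≡ Arrows.arrows Δ (π ⟨$⟩ˡ i) (π ⟨$⟩ˡ j)
  arrows-permute π Δ i j = cong₂ _+_ (meets-permute _) (meets-permute _)
    where
    open Triangulation Δ

    meets-permute : ∀ h → Arrows.meets (permuteEdges π Δ) h j ≡ Arrows.meets Δ h (π ⟨$⟩ˡ j)
    meets-permute h = indicator-⇔ (λ e → trans (sym (Perm.inverseˡ π)) (cong (π ⟨$⟩ˡ_) e))
      (λ e → trans (cong (π ⟨$⟩ʳ_) e) (Perm.inverseʳ π)) (_ Fin.≟ _) (_ Fin.≟ _)

  -- The flip of an edge

  module Flip {n} (Δ : Triangulation n) (k : Fin n) where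
    open Triangulation Δ
    open Arrows Δ

    -- Names for the six sides of the two triangles at `k`. The Boolean chooses the triangle;
    -- position `0F` is its side on `k`, the diagonal of the quadrilateral.
    Corner : Set
    Corner = Bool × Fin 3

    _≟ᶜ_ : DecidableEquality Corner
    _≟ᶜ_ = ≡-dec Bool._≟_ Fin._≟_

    diagonal : Bool → H
    diagonal true  = side k
    diagonal false = glue (side k)

    corner : Corner → H
    corner (b , 0F) = diagonal b
    corner (b , 1F) = succ (diagonal b)
    corner (b , 2F) = succ (succ (diagonal b))

    glue-diagonal : ∀ b → glue (diagonal b) ≡ diagonal (not b)
    glue-diagonal true  = refl
    glue-diagonal false = glue-involutive (side k)

    edge-diagonal : ∀ b → edge (diagonal b) ≡ k
    edge-diagonal true  = edge-side k
    edge-diagonal false = trans (edge-glue _) (edge-side k)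

    succ-corner : ∀ b p → succ (corner (b , p)) ≡ corner (b , next p)
    succ-corner b 0F = refl
    succ-corner b 1F = refl
    succ-corner b 2F = succ³ _

    corner≢diagonal : ∀ b b′ p → (b , p) ≢ (b′ , 0F) → corner (b , p) ≢ diagonal b′
    corner≢diagonal b b′ p ≢c e with b Bool.≟ b′
    corner≢diagonal b b′ 0F ≢c e | yes refl = ≢c refl
    corner≢diagonal b b′ 1F ≢c e | yes refl = succ-other _ e
    corner≢diagonal b b′ 2F ≢c e | yes refl = succ-other _ (trans (cong succ (sym e)) (succ³ _))
    corner≢diagonal b b′ p  ≢c e | no b≢b′ = distinct-triangles p (trans e (trans
      (cong diagonal (¬-not (b≢b′ ∘ sym))) (sym (glue-diagonal b))))
      where
      distinct-triangles : ∀ p → corner (b , p) ≢ glue (diagonal b)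
      distinct-triangles 0F e = glue-other _ (sym e)
      distinct-triangles 1F e = succ≢glue _ e
      distinct-triangles 2F e = succ≢glue _ (trans (cong succ (sym e)) (trans (succ³ _) (sym (glue-involutive _))))

    corner≡diagonal : ∀ b p b′ → corner (b , p) ≡ diagonal b′ → (b , p) ≡ (b′ , 0F)
    corner≡diagonal b p b′ e with (b , p) ≟ᶜ (b′ , 0F)
    ... | yes c≡ = c≡
    ... | no c≢  = contradiction e (corner≢diagonal b b′ p c≢)

    nextCorner : Corner → Corner
    nextCorner (b , p) = b , next p

    nextCorner³ : ∀ c → nextCorner (nextCorner (nextCorner c)) ≡ c
    nextCorner³ (b , 0F) = refl
    nextCorner³ (b , 1F) = refl
    nextCorner³ (b , 2F) = refl

    -- Both corners are rotated until the second lies on the diagonal. The two triangles do not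
    -- coincide because no edge is self-folded.
    corner-injective : ∀ {c c′} → corner c ≡ corner c′ → c ≡ c′
    corner-injective {b , p} {b′ , 0F} e = corner≡diagonal b p b′ e
    corner-injective {b , p} {b′ , 1F} e = trans (sym (nextCorner³ (b , p))) (cong nextCorner
      (corner≡diagonal b (next (next p)) b′ (begin
        corner (b , next (next p))   ≡⟨ succ-corner b (next p) ⟨
        succ (corner (b , next p))   ≡⟨ cong succ (succ-corner b p) ⟨
        succ (succ (corner (b , p))) ≡⟨ cong (succ ∘ succ) e ⟩
        succ³-diagonal               ≡⟨ succ³ _ ⟩
        diagonal b′                  ∎)))
      where
      open ≡-Reasoning
      succ³-diagonal = succ (succ (succ (diagonal b′)))
    corner-injective {b , p} {b′ , 2F} e = trans (sym (nextCorner³ (b , p))) (cong (nextCorner ∘ nextCorner)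
      (corner≡diagonal b (next p) b′ (trans (sym (succ-corner b p)) (trans (cong succ e) (succ³ _)))))

    -- Abstract because unfolding nested applications of flipSucc does not terminate in reasonable time.
    abstract
      corner? : ∀ h → Dec (∃ λ c → corner c ≡ h)
      corner? h = map′
        [ (λ (p , e) → (true , p) , e) , (λ (p , e) → (false , p) , e) ]′
        (λ { ((true , p) , e) → inj₁ (p , e) ; ((false , p) , e) → inj₂ (p , e) })
        (any? (λ p → corner (true , p) ≟ᴴ h) ⊎-dec any? (λ p → corner (false , p) ≟ᴴ h))

    module _ {A : Set} (u : Corner → A) (f : H → A) where

      override : H → A
      override h with corner? h
      ... | yes (c , _) = u c
      ... | no _        = f h

      override-corner : ∀ c → override (corner c) ≡ u c
      override-corner c with corner? (corner c)
      ... | yes (c′ , e) = cong u (corner-injective e)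
      ... | no ¬c        = contradiction (c , refl) ¬c

      override-other : ∀ {h} → ¬ (∃ λ c → corner c ≡ h) → override h ≡ f h
      override-other {h} ¬c with corner? h
      ... | yes c = contradiction c ¬c
      ... | no _  = refl

    -- With sides (k, a, b) and (glue k, c, d) of the two triangles, the flipped
    -- triangles have the sides (k, b, c) and (glue k, d, a).
    turn : Corner → Corner
    turn (b , 0F) = b , 2F
    turn (b , 1F) = not b , 0F
    turn (b , 2F) = not b , 1F

    turn³ : ∀ c → turn (turn (turn c)) ≡ c
    turn³ (b , 0F) = cong (_, 0F) (not-involutive b)
    turn³ (b , 1F) = cong (_, 1F) (not-involutive b)
    turn³ (b , 2F) = cong (_, 2F) (not-involutive b)

    turn-other : ∀ c → turn c ≢ c
    turn-other (b , 0F) ()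
    turn-other (b , 1F) ()
    turn-other (b , 2F) ()

    flipSucc : H → H
    flipSucc = override (corner ∘ turn) succ

    flipSucc-corner : ∀ c → flipSucc (corner c) ≡ corner (turn c)
    flipSucc-corner = override-corner (corner ∘ turn) succ

    flipSucc-other : ∀ {h} → ¬ (∃ λ c → corner c ≡ h) → flipSucc h ≡ succ h
    flipSucc-other = override-other (corner ∘ turn) succ

    succ-not-corner : ∀ {h} → ¬ (∃ λ c → corner c ≡ h) → ¬ (∃ λ c → corner c ≡ succ h)
    succ-not-corner ¬c ((b , p) , e) = ¬c ((b , next (next p)) , (begin
      corner (b , next (next p))   ≡⟨ succ-corner b (next p) ⟨
      succ (corner (b , next p))   ≡⟨ cong succ (succ-corner b p) ⟨
      succ (succ (corner (b , p))) ≡⟨ pred≡ (sym e) ⟨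
      _                            ∎))
      where open ≡-Reasoning

    flipSucc³ : ∀ h → flipSucc (flipSucc (flipSucc h)) ≡ h
    flipSucc³ h = by-cases (corner? h)
      where
      open ≡-Reasoning
      by-cases : Dec (∃ λ c → corner c ≡ h) → flipSucc (flipSucc (flipSucc h)) ≡ h
      by-cases (yes (c , refl)) = begin
        flipSucc (flipSucc (flipSucc (corner c))) ≡⟨ cong (flipSucc ∘ flipSucc) (flipSucc-corner c) ⟩
        flipSucc (flipSucc (corner (turn c)))     ≡⟨ cong flipSucc (flipSucc-corner (turn c)) ⟩
        flipSucc (corner (turn (turn c)))         ≡⟨ flipSucc-corner (turn (turn c)) ⟩
        corner (turn (turn (turn c)))             ≡⟨ cong corner (turn³ c) ⟩
        corner c                                  ∎
      by-cases (no ¬c) = begin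
        flipSucc (flipSucc (flipSucc h)) ≡⟨ cong (flipSucc ∘ flipSucc) (flipSucc-other ¬c) ⟩
        flipSucc (flipSucc (succ h))     ≡⟨ cong flipSucc (flipSucc-other ¬sc) ⟩
        flipSucc (succ (succ h))         ≡⟨ flipSucc-other (succ-not-corner ¬sc) ⟩
        succ (succ (succ h))             ≡⟨ succ³ h ⟩
        h                                ∎
        where ¬sc = succ-not-corner ¬c

    flipSucc-≢ : ∀ h → flipSucc h ≢ h
    flipSucc-≢ h e = by-cases (corner? h)
      where
      by-cases : ¬ Dec (∃ λ c → corner c ≡ h)
      by-cases (yes (c , refl)) = turn-other c (corner-injective (trans (sym (flipSucc-corner c)) e))
      by-cases (no ¬c)          = succ-other h (trans (sym (flipSucc-other ¬c)) e)

    -- Preservation of the single vertex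

    module _ (f : H → Bool) (f-invariant : ∀ h → f (flipSucc h) ≡ f (glue h)) where

      -- The diagonal moves to another place of the cyclic order around the
      -- vertex; f is changed on it to be invariant for the old order.
      moved : Corner → Bool
      moved (b , 0F) = f (corner (not b , 1F))
      moved (b , p)  = f (corner (b , p))

      g : H → Bool
      g = override moved f

      g-corner : ∀ c → g (corner c) ≡ moved c
      g-corner = override-corner moved f

      g-off-diagonal : ∀ h → (∀ b → h ≢ diagonal b) → g h ≡ f h
      g-off-diagonal h off with corner? h
      ... | yes ((b , 0F) , e)    = contradiction (sym e) (off b)
      ... | yes ((b , 1F) , refl) = refl
      ... | yes ((b , 2F) , refl) = refl
      ... | no _                  = refl

      glue-off-diagonal : ∀ h → (∀ b → h ≢ diagonal b) → g (glue h) ≡ f (glue h)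
      glue-off-diagonal h off = g-off-diagonal (glue h) λ b e → off (not b)
        (trans (sym (glue-involutive h)) (trans (cong glue e) (glue-diagonal b)))

      f-corner : ∀ c → f (corner (turn c)) ≡ f (glue (corner c))
      f-corner c = trans (cong f (sym (flipSucc-corner c))) (f-invariant (corner c))

      f-diagonal : ∀ b → f (diagonal (not b)) ≡ f (corner (b , 2F))
      f-diagonal b = trans (cong f (sym (glue-diagonal b))) (sym (f-corner (b , 0F)))

      g-invariant : ∀ h → g (succ h) ≡ g (glue h)
      g-invariant h = by-cases (corner? h)
        where
        open ≡-Reasoning
        by-cases : Dec (∃ λ c → corner c ≡ h) → g (succ h) ≡ g (glue h)
        by-cases (yes ((b , 0F) , refl)) = begin
          g (corner (b , 1F))             ≡⟨ g-corner (b , 1F) ⟩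
          f (corner (b , 1F))             ≡⟨ cong (λ b → f (corner (b , 1F))) (not-involutive b) ⟨
          f (corner (not (not b) , 1F))   ≡⟨ g-corner (not b , 0F) ⟨
          g (diagonal (not b))            ≡⟨ cong g (glue-diagonal b) ⟨
          g (glue (diagonal b))           ∎
        -- In the new order the start of `diagonal (not b)` lies between these two edge ends, so the
        -- invariance of `f` is used twice.
        by-cases (yes ((b , 1F) , refl)) = begin
          g (corner (b , 2F))             ≡⟨ g-corner (b , 2F) ⟩
          f (corner (b , 2F))             ≡⟨ f-diagonal b ⟨
          f (diagonal (not b))            ≡⟨ f-corner (b , 1F) ⟩
          f (glue (corner (b , 1F)))      ≡⟨ glue-off-diagonal _ (λ b′ → corner≢diagonal b b′ 1F λ ()) ⟨
          g (glue (corner (b , 1F)))      ∎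
        by-cases (yes ((b , 2F) , refl)) = begin
          g (succ (corner (b , 2F)))      ≡⟨ cong g (succ-corner b 2F) ⟩
          g (corner (b , 0F))             ≡⟨ g-corner (b , 0F) ⟩
          f (corner (not b , 1F))         ≡⟨ f-corner (b , 2F) ⟩
          f (glue (corner (b , 2F)))      ≡⟨ glue-off-diagonal _ (λ b′ → corner≢diagonal b b′ 2F λ ()) ⟨
          g (glue (corner (b , 2F)))      ∎
        by-cases (no ¬c) = begin
          g (succ h)                      ≡⟨ override-other moved f (succ-not-corner ¬c) ⟩
          f (succ h)                      ≡⟨ cong f (flipSucc-other ¬c) ⟨
          f (flipSucc h)                  ≡⟨ f-invariant h ⟩
          f (glue h)                      ≡⟨ glue-off-diagonal h (λ b e → ¬c ((b , 0F) , sym e)) ⟨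
          g (glue h)                      ∎

      -- Only the values of `f` on the diagonal are overwritten in `g`, and by `f-diagonal` they
      -- recur at the corners `2F`. Hence `f` is constant as soon as `g` is.
      f-value : ∀ h → ∃ λ h′ → f h ≡ g h′
      f-value h with corner? h
      ... | yes ((true , 0F) , refl)  = _ , trans (f-diagonal false) (sym (g-corner (false , 2F)))
      ... | yes ((false , 0F) , refl) = _ , trans (f-diagonal true) (sym (g-corner (true , 2F)))
      ... | yes ((b , 1F) , refl)     = _ , sym (g-corner (b , 1F))
      ... | yes ((b , 2F) , refl)     = _ , sym (g-corner (b , 2F))
      ... | no ¬c                     = h , sym (override-other moved f ¬c)

      flip-one-vertex : ∀ h h′ → f h ≡ f h′
      flip-one-vertex h h′ with f-value h | f-value h′
      ... | _ , e | _ , e′ = trans e (trans (one-vertex g g-invariant _ _) (sym e′))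

    flip : Triangulation n
    flip = record
      { edge           = edge
      ; edge-glue      = edge-glue
      ; edge-injective = edge-injective
      ; side           = side
      ; edge-side      = edge-side
      ; succ           = flipSucc
      ; succ³          = flipSucc³
      ; succ-other     = flipSucc-≢
      ; one-vertex     = flip-one-vertex
      }

    -- Arrows of the flipped triangulation

    open Arrows flip using () renaming (arrows to arrows′; arrows-into to arrows′-into)

    across : Corner → Fin n → ℕ
    across c j = meets (corner c) j

    arrows-into-k : ∀ i → arrows i k ≡ across (true , 2F) i + across (false , 2F) i
    arrows-into-k i = arrows-into i k

    -- A flip reverses the arrows at `k`: by `turn`, each side of `k` is now followed by the side
    -- that used to precede it.
    flip-arrows-from-k : ∀ j → arrows′ k j ≡ arrows j k
    flip-arrows-from-k j = trans
      (cong₂ _+_ (cong (λ h → meets h j) (flipSucc-corner (true , 0F)))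
                 (cong (λ h → meets h j) (flipSucc-corner (false , 0F))))
      (sym (arrows-into-k j))

    flip-arrows-into-k : ∀ i → arrows′ i k ≡ arrows k i
    flip-arrows-into-k i = trans (arrows′-into i k) (trans
      (cong₂ _+_ (cong (λ h → meets h i) (flip² true)) (cong (λ h → meets h i) (flip² false)))
      -- The side now preceding `diagonal b` comes from the other old triangle, so the summands
      -- appear in swapped order.
      (+-comm (across (false , 1F) i) _))
      where
      flip² : ∀ b → flipSucc (flipSucc (diagonal b)) ≡ corner (not b , 1F)
      flip² b = trans (cong flipSucc (flipSucc-corner (b , 0F))) (flipSucc-corner (b , 2F))

    meets-flipSucc-1F : ∀ b {j} → j ≢ k → meets (flipSucc (corner (b , 1F))) j ≡ 0
    meets-flipSucc-1F b j≢k = trans (cong (λ h → meets h _) (flipSucc-corner (b , 1F)))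
      (indicator-false (_ Fin.≟ _) λ e → j≢k (trans (sym e) (edge-diagonal (not b))))

    meets-succ-2F : ∀ b {j} → j ≢ k → meets (succ (corner (b , 2F))) j ≡ 0
    meets-succ-2F b j≢k = trans (cong (λ h → meets h _) (succ³ _))
      (indicator-false (_ Fin.≟ _) λ e → j≢k (trans (sym e) (edge-diagonal b)))

    at : Corner → H → ℕ
    at c h = indicator (h ≟ᴴ corner c)

    at-corner : ∀ c c′ → at c (corner c′) ≡ indicator (c′ ≟ᶜ c)
    at-corner c c′ = indicator-⇔ (corner-injective {c′} {c}) (cong corner) (_ ≟ᴴ _) (_ ≟ᶜ _)

    at-other : ∀ c {h} → ¬ (∃ λ c → corner c ≡ h) → at c h ≡ 0
    at-other c ¬c = indicator-false (_ ≟ᴴ _) λ e → ¬c (c , sym e)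

    -- Away from `k` only four sides change successor: `1F` loses its arrow to `2F` of the same
    -- triangle, and `2F` gains one to `1F` of the other. Lost arrows are added on the left and
    -- gained ones on the right, which avoids subtraction.
    meets-flip : ∀ {h j} → edge h ≢ k → j ≢ k →
      meets (flipSucc h) j + (at (true , 1F) h * across (true , 2F) j + at (false , 1F) h * across (false , 2F) j) ≡
      meets (succ h) j + (at (true , 2F) h * across (false , 1F) j + at (false , 2F) h * across (true , 1F) j)
    meets-flip {h} {j} h≢k j≢k = by-cases h h≢k (corner? h)
      where
      X = across (true , 2F) j
      Y = across (false , 2F) j
      Z = across (false , 1F) j
      W = across (true , 1F) j

      given : ∀ {m m′ p p′ q q′ n n′ r r′ s s′} →
        m ≡ m′ → p ≡ p′ → q ≡ q′ → n ≡ n′ → r ≡ r′ → s ≡ s′ →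
        m′ + (p′ * X + q′ * Y) ≡ n′ + (r′ * Z + s′ * W) → m + (p * X + q * Y) ≡ n + (r * Z + s * W)
      given refl refl refl refl refl refl e = e

      unit-left : ∀ x → 1 * x + 0 ≡ x + 0
      unit-left x = cong (_+ 0) (+-identityʳ x)

      unit-right : ∀ x → 1 * x ≡ x + 0
      unit-right x = refl

      by-cases : ∀ h → edge h ≢ k → Dec (∃ λ c → corner c ≡ h) →
        meets (flipSucc h) j + (at (true , 1F) h * X + at (false , 1F) h * Y) ≡
        meets (succ h) j + (at (true , 2F) h * Z + at (false , 2F) h * W)
      by-cases _ h≢k (yes ((b , 0F) , refl)) = contradiction (edge-diagonal b) h≢k
      by-cases _ _ (yes (c@(true , 1F) , refl)) = given (meets-flipSucc-1F true j≢k)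
        (at-corner (true , 1F) c) (at-corner (false , 1F) c) refl
        (at-corner (true , 2F) c) (at-corner (false , 2F) c) (unit-left X)
      by-cases _ _ (yes (c@(false , 1F) , refl)) = given (meets-flipSucc-1F false j≢k)
        (at-corner (true , 1F) c) (at-corner (false , 1F) c) refl
        (at-corner (true , 2F) c) (at-corner (false , 2F) c) (unit-right Y)
      by-cases _ _ (yes (c@(true , 2F) , refl)) = given (cong (λ h → meets h j) (flipSucc-corner c))
        (at-corner (true , 1F) c) (at-corner (false , 1F) c) (meets-succ-2F true j≢k)
        (at-corner (true , 2F) c) (at-corner (false , 2F) c) (sym (unit-left Z))
      by-cases _ _ (yes (c@(false , 2F) , refl)) = given (cong (λ h → meets h j) (flipSucc-corner c))
        (at-corner (true , 1F) c) (at-corner (false , 1F) c) (meets-succ-2F false j≢k)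
        (at-corner (true , 2F) c) (at-corner (false , 2F) c) (sym (unit-right W))
      by-cases h _ (no ¬c) = given (cong (λ h → meets h j) (flipSucc-other ¬c))
        (at-other (true , 1F) ¬c) (at-other (false , 1F) ¬c) refl
        (at-other (true , 2F) ¬c) (at-other (false , 2F) ¬c) refl

    incidence-corner : ∀ i c → at c (side i) + at c (glue (side i)) ≡ across c i
    incidence-corner i c = incidence i (corner c)

    -- `meets-flip` is summed over both sides of i; by `incidence` the terms `at c` then add up to
    -- `across c i`.
    arrows-flip : ∀ {i j} → i ≢ k → j ≢ k →
      arrows′ i j + (across (true , 1F) i * across (true , 2F) j + across (false , 1F) i * across (false , 2F) j) ≡
      arrows i j + (across (true , 2F) i * across (false , 1F) j + across (false , 2F) i * across (true , 1F) j)
    arrows-flip {i} {j} i≢k j≢k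
      rewrite sym (incidence-corner i (true , 1F)) | sym (incidence-corner i (false , 1F))
            | sym (incidence-corner i (true , 2F)) | sym (incidence-corner i (false , 2F))
      = trans (collect (meets (flipSucc (side i)) j) _ (at (true , 1F) (side i)) _ (at (false , 1F) (side i)) _ _ _) (trans
          (cong₂ _+_ (meets-flip (i≢k ∘ trans (sym (edge-side i))) j≢k)
                     (meets-flip (i≢k ∘ trans (sym (trans (edge-glue _) (edge-side i)))) j≢k))
          (sym (collect (meets (succ (side i)) j) _ (at (true , 2F) (side i)) _ (at (false , 2F) (side i)) _ _ _)))
      where
      collect : ∀ m m′ a a′ b b′ x y →
        (m + m′) + ((a + a′) * x + (b + b′) * y) ≡ (m + (a * x + b * y)) + (m′ + (a′ * x + b′ * y))
      collect = solve-∀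

    -- The mutation rule, with all terms moved to their positive side to stay in ℕ.
    arrows-mutation : ∀ {i j} → i ≢ k → j ≢ k →
      (arrows′ i j + arrows j i) + arrows k i * arrows j k ≡ (arrows i j + arrows′ j i) + arrows i k * arrows k j
    arrows-mutation {i} {j} i≢k j≢k rewrite arrows-into-k i | arrows-into-k j =
      trans (regroup (arrows′ i j) (arrows j i) (across (true , 1F) i) (across (false , 1F) i) (across (true , 2F) j) _) (trans
        -- Paths j → k → i within one triangle account for the arrows i → j that are lost, and those
        -- passing between the two triangles for the arrows j → i that are gained. The identity for
        -- (j, i) is therefore used backwards.
        (cong₂ _+_ (arrows-flip i≢k j≢k) (sym (arrows-flip j≢k i≢k)))
        (regroup′ (arrows i j) (arrows′ j i) (across (true , 2F) i) (across (false , 2F) i) (across (true , 1F) j) _))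
      where
      regroup : ∀ m m′ a c x z →
        (m + m′) + (a + c) * (x + z) ≡ (m + (a * x + c * z)) + (m′ + (x * c + z * a))
      regroup = solve-∀
      regroup′ : ∀ m m′ a c x z →
        (m + (a * z + c * x)) + (m′ + (x * a + z * c)) ≡ (m + m′) + (a + c) * (x + z)
      regroup′ = solve-∀

  -- Matrix mutation as a flip

  exchange : ∀ {n} → Triangulation n → Matrix n
  exchange Δ i j = + arrows i j - + arrows j i
    where open Arrows Δ

  exchange-skew : ∀ {n} (Δ : Triangulation n) i j → - exchange Δ i j ≡ exchange Δ j i
  exchange-skew Δ i j = negate (+ arrows i j) (+ arrows j i)
    where
    open Arrows Δ
    negate : ∀ p q → - (p - q) ≡ q - p
    negate = ℤ.solve-∀

  -- Row and column k change sign because the flip reverses the arrows at k. Elsewhere `no-2-cycle`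
  -- brings the rule into product form, which is `arrows-mutation`.
  mutateMatrix-flip : ∀ {n} (Δ : Triangulation n) k (B : Matrix n) → (∀ i j → B i j ≡ exchange Δ i j) →
    ∀ i j → mutateMatrix k B i j ≡ exchange (Flip.flip Δ k) i j
  mutateMatrix-flip Δ k B B≡ i j with i Fin.≟ k | j Fin.≟ k
  ... | yes refl | _ = trans (cong -_ (B≡ i j)) (trans (exchange-skew Δ i j)
      (cong₂ (λ p q → + p - + q) (sym (Flip.flip-arrows-from-k Δ i j)) (sym (Flip.flip-arrows-into-k Δ i j))))
  ... | no _ | yes refl = trans (cong -_ (B≡ i j)) (trans (exchange-skew Δ i j)
      (cong₂ (λ p q → + p - + q) (sym (Flip.flip-arrows-into-k Δ j i)) (sym (Flip.flip-arrows-from-k Δ j i))))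
  ... | no i≢k | no j≢k rewrite B≡ i j | B≡ i k | B≡ k j = begin
    mutateEntry (exchange Δ i j) (exchange Δ i k) (exchange Δ k j)
      ≡⟨ mutateEntry-parts (exchange Δ i j) (arrows i k) (arrows k i) (arrows k j) (arrows j k)
           (no-2-cycle i k) (no-2-cycle k j) ⟩
    exchange Δ i j ℤ.+ (+ (arrows i k * arrows k j) - + (arrows k i * arrows j k))
      ≡⟨ move-terms (arrows i j) (arrows j i) (arrows i k * arrows k j) (arrows k i * arrows j k)
           (Arrows.arrows (Flip.flip Δ k) i j) (Arrows.arrows (Flip.flip Δ k) j i) (Flip.arrows-mutation Δ k i≢k j≢k) ⟩
    exchange (Flip.flip Δ k) i j ∎
    where
    open ≡-Reasoning
    open Arrows Δ
    move-terms : ∀ a b c d a′ b′ → (a′ + b) + d ≡ (a + b′) + c →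
      (+ a - + b) ℤ.+ (+ c - + d) ≡ + a′ - + b′
    move-terms a b c d a′ b′ e = begin
      (+ a - + b) ℤ.+ (+ c - + d)                              ≡⟨ left (+ a) (+ b) (+ c) (+ d) (+ b′) ⟩
      ((+ a ℤ.+ + b′) ℤ.+ + c) - (+ b ℤ.+ + d ℤ.+ + b′)        ≡⟨ cong (λ m → + m - (+ b ℤ.+ + d ℤ.+ + b′)) e ⟨
      ((+ a′ ℤ.+ + b) ℤ.+ + d) - (+ b ℤ.+ + d ℤ.+ + b′)        ≡⟨ right (+ a′) (+ b) (+ d) (+ b′) ⟩
      + a′ - + b′                                              ∎
      where
      left : ∀ a b c d b′ → (a - b) ℤ.+ (c - d) ≡ ((a ℤ.+ b′) ℤ.+ c) - (b ℤ.+ d ℤ.+ b′)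
      left = ℤ.solve-∀
      right : ∀ a′ b d b′ → ((a′ ℤ.+ b) ℤ.+ d) - (b ℤ.+ d ℤ.+ b′) ≡ a′ - b′
      right = ℤ.solve-∀

  -- Invariance of the sum of the c-vectors

  module _ {n} (Δ : Triangulation n) (k : Fin n) (B : Matrix n) (B≡ : ∀ i j → B i j ≡ exchange Δ i j)
    (Y : Coefficients n) (l : Fin n) where
    open Triangulation Δ
    open Arrows Δ

    private
      y u v : ℤ
      y = Y k l
      u = -1ℤ ℤ.* y ⊓ 0ℤ
      v = y ⊓ 0ℤ

      a b c d : H
      a = succ (side k)
      b = succ a
      c = succ (glue (side k))
      d = succ c

      add : H → ℤ → (Fin n → ℤ) → Fin n → ℤ
      add h z f i = f i ℤ.+ + meets h i ℤ.* z

      -- Each of the four arrows at `k` contributes at its other end: the targets `a`, `c` receive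
      -- -u and the sources `b`, `d` receive v.
      factors : Fin n → ℤ
      factors = add d v (add b v (add c (- u) (add a (- u) (λ i → Y i l))))

    factors-arrows : ∀ i → (Y i l ℤ.+ + arrows k i ℤ.* (- u)) ℤ.+ + arrows i k ℤ.* v ≡ factors i
    factors-arrows i rewrite arrows-into i k =
      expand (Y i l) (+ meets a i) (+ meets c i) (+ meets b i) (+ meets d i) (- u) v
      where
      expand : ∀ z a c b d u v → (z ℤ.+ (a ℤ.+ c) ℤ.* u) ℤ.+ (b ℤ.+ d) ℤ.* v ≡
        (((z ℤ.+ a ℤ.* u) ℤ.+ c ℤ.* u) ℤ.+ b ℤ.* v) ℤ.+ d ℤ.* v
      expand = ℤ.solve-∀

    -- At `k` itself there is no loop, so `factors` still has the exponent y, and the correction -2y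
    -- turns it into -y.
    mutated-coefficient : ∀ i →
      mutateCoefficients k B Y i l ≡ factors i ℤ.+ + indicator (k Fin.≟ i) ℤ.* (- (y ℤ.+ y))
    mutated-coefficient i with i Fin.≟ k
    ... | yes refl = begin
      -1ℤ ℤ.* y                                              ≡⟨ invert y u v ⟩
      ((y ℤ.+ 0ℤ ℤ.* (- u)) ℤ.+ 0ℤ ℤ.* v) ℤ.+ 1ℤ ℤ.* (- (y ℤ.+ y))
        ≡⟨ cong₂ (λ p q → ((y ℤ.+ + p ℤ.* (- u)) ℤ.+ + p ℤ.* v) ℤ.+ + q ℤ.* (- (y ℤ.+ y)))
             (no-loop i) (indicator-true (i Fin.≟ i) refl) ⟨
      ((y ℤ.+ + arrows i i ℤ.* (- u)) ℤ.+ + arrows i i ℤ.* v) ℤ.+ + indicator (i Fin.≟ i) ℤ.* (- (y ℤ.+ y))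
        ≡⟨ cong (λ x → x ℤ.+ + indicator (i Fin.≟ i) ℤ.* (- (y ℤ.+ y))) (factors-arrows i) ⟩
      factors i ℤ.+ + indicator (i Fin.≟ i) ℤ.* (- (y ℤ.+ y)) ∎
      where
      open ≡-Reasoning
      invert : ∀ y u v → -1ℤ ℤ.* y ≡ ((y ℤ.+ 0ℤ ℤ.* (- u)) ℤ.+ 0ℤ ℤ.* v) ℤ.+ 1ℤ ℤ.* (- (y ℤ.+ y))
      invert = ℤ.solve-∀
    ... | no i≢k = begin
      _                                           ≡⟨ if-apply (does (0ℤ ℤ.≤? B k i)) ⟩
      coefficientFactor (Y i l) (B k i) y         ≡⟨ cong (λ x → coefficientFactor (Y i l) x y) (B≡ k i) ⟩
      coefficientFactor (Y i l) (exchange Δ k i) y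
        ≡⟨ coefficientFactor-parts (Y i l) (arrows k i) (arrows i k) y (no-2-cycle k i) ⟩
      (Y i l ℤ.+ + arrows k i ℤ.* (- u)) ℤ.+ + arrows i k ℤ.* v
                                                  ≡⟨ factors-arrows i ⟩
      factors i                                   ≡⟨ ℤ.+-identityʳ (factors i) ⟨
      factors i ℤ.+ 0ℤ
        ≡⟨ cong (λ q → factors i ℤ.+ + q ℤ.* (- (y ℤ.+ y))) (indicator-false (k Fin.≟ i) (i≢k ∘ sym)) ⟨
      factors i ℤ.+ + indicator (k Fin.≟ i) ℤ.* (- (y ℤ.+ y)) ∎
      where
      open ≡-Reasoning
      if-apply : ∀ {f g : Trop n} b → (if b then f else g) l ≡ (if b then f l else g l)
      if-apply true  = refl
      if-apply false = refl

    sum-mutated : sum (λ i → mutateCoefficients k B Y i l) ≡ sum (λ i → Y i l)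
    sum-mutated = begin
      sum (λ i → mutateCoefficients k B Y i l)
        ≡⟨ sum-cong-≗ mutated-coefficient ⟩
      sum (λ i → factors i ℤ.+ + indicator (k Fin.≟ i) ℤ.* (- (y ℤ.+ y)))
        ≡⟨ sum-update factors k _ ⟩
      sum factors - (y ℤ.+ y)
        ≡⟨ cong (_- (y ℤ.+ y)) (sum-add d v _ (sum-add b v _ (sum-add c (- u) _ (sum-add a (- u) _ refl)))) ⟩
      ((((sum (λ i → Y i l) - u) - u) ℤ.+ v) ℤ.+ v) - (y ℤ.+ y)
        -- With v = y + u the total change -2u + 2v - 2y vanishes.
        ≡⟨ cong (λ v → ((((sum (λ i → Y i l) - u) - u) ℤ.+ v) ℤ.+ v) - (y ℤ.+ y)) (min-difference y) ⟩
      ((((sum (λ i → Y i l) - u) - u) ℤ.+ (y ℤ.+ u)) ℤ.+ (y ℤ.+ u)) - (y ℤ.+ y)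
        ≡⟨ cancel (sum (λ i → Y i l)) y u ⟩
      sum (λ i → Y i l) ∎
      where
      open ≡-Reasoning
      sum-add : ∀ h z f {x} → sum f ≡ x → sum (add h z f) ≡ x ℤ.+ z
      sum-add h z f e = trans (sum-update f (edge h) z) (cong (ℤ._+ z) e)
      cancel : ∀ s y u → ((((s - u) - u) ℤ.+ (y ℤ.+ u)) ℤ.+ (y ℤ.+ u)) - (y ℤ.+ y) ≡ s
      cancel = ℤ.solve-∀

  -- The invariant along a mutation sequence

  record Balanced {n} (s : Seed n) : Set where
    field
      triangulation : Triangulation n
      matrix        : ∀ i j → proj₁ s i j ≡ exchange triangulation i j
      sum-c-vectors : ∀ l → sum (λ i → proj₂ s i l) ≡ 1ℤ

  balanced-mutate : ∀ {n} k {s : Seed n} → Balanced s → Balanced (mutate k s)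
  balanced-mutate k {B , Y} bal = record
    { triangulation = Flip.flip triangulation k
    ; matrix        = mutateMatrix-flip triangulation k B matrix
    ; sum-c-vectors = λ l → trans (sum-mutated triangulation k B matrix Y l) (sum-c-vectors l)
    }
    where open Balanced bal

  balanced-permute : ∀ {n} π {s : Seed n} → Balanced s → Balanced (permute π s)
  balanced-permute π {B , Y} bal = record
    { triangulation = permuteEdges π triangulation
    ; matrix        = λ i j → trans (matrix _ _) (cong₂ (λ p q → + p - + q)
        (sym (arrows-permute π triangulation i j)) (sym (arrows-permute π triangulation j i)))
    -- `permute` reads the coefficients through the inverse of π, hence `Perm.flip π`.
    ; sum-c-vectors = λ l → trans (sym (sum-permute (λ i → Y i l) (Perm.flip π))) (sum-c-vectors l)
    }
    where open Balanced bal

  balanced-seedAfter : ∀ {n T} {s : Seed n} (m : Vec (Fin n) T) σ → Balanced s → ∀ t → Balanced (seedAfter s m σ t)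
  balanced-seedAfter m       σ       bal zero    = bal
  balanced-seedAfter (k ∷ m) (π ∷ σ) bal (suc t) =
    balanced-seedAfter m σ (balanced-permute π (balanced-mutate k bal)) t

-- The initial seed

module _ {n} (Γ : IdealTriangulation n) (once-punctured : OncePunctured Γ) where
  open IdealTriangulation Γ

  _≟ˢ_ : DecidableEquality (Side N)
  _≟ˢ_ = ≡-dec Fin._≟_ Fin._≟_

  open Triangulations _≟ˢ_ glue glue-involutive glue-other

  next≢ : ∀ p → next p ≢ p
  next≢ 0F ()
  next≢ 1F ()
  next≢ 2F ()

  next²≢ : ∀ p → next (next p) ≢ p
  next²≢ 0F ()
  next²≢ 1F ()
  next²≢ 2F ()

  next³ : ∀ p → next (next (next p)) ≡ p
  next³ 0F = refl
  next³ 1F = refl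
  next³ 2F = refl

  triangulation₀ : Triangulation n
  triangulation₀ = record
    { edge           = edge
    ; edge-glue      = edge-glue
    ; edge-injective = edge-injective
    ; side           = λ i → proj₁ (edge-surjective i)
    ; edge-side      = λ i → proj₂ (edge-surjective i)
    ; succ           = nextSide
    ; succ³          = λ (t , p) → cong (t ,_) (next³ p)
    ; succ-other     = λ (t , p) e → next≢ p (cong proj₂ e)
    -- Equality of values of `f` is carried along the equivalence closure. A `CornerStep` from s
    -- glues first, so invariance is applied at `glue s`.
    ; one-vertex     = λ f f-invariant h h′ → gfold isEquivalence f (λ { {s} refl →
        trans (cong f (sym (glue-involutive s))) (sym (f-invariant (glue s))) }) (proj₂ once-punctured h h′)
    }

  open Triangulation triangulation₀ using (side)
  open Arrows triangulation₀ using (meets; incidence)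

  sumSides : (Side N → ℤ) → ℤ
  sumSides f = sum λ t → sum λ p → f (t , p)

  sumSides-update : ∀ f x c → sumSides (λ s → f s ℤ.+ + indicator (x ≟ˢ s) ℤ.* c) ≡ sumSides f ℤ.+ c
  sumSides-update f (u , q) c = trans (sum-cong-≗ at-triangle) (sum-update (λ t → sum λ p → f (t , p)) u c)
    where
    at-triangle : ∀ t → sum (λ p → f (t , p) ℤ.+ + indicator ((u , q) ≟ˢ (t , p)) ℤ.* c) ≡
      sum (λ p → f (t , p)) ℤ.+ + indicator (u Fin.≟ t) ℤ.* c
    at-triangle t = by-cases (u Fin.≟ t)
      where
      by-cases : (u≟t : Dec (u ≡ t)) → sum (λ p → f (t , p) ℤ.+ + indicator ((u , q) ≟ˢ (t , p)) ℤ.* c) ≡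
        sum (λ p → f (t , p)) ℤ.+ + indicator u≟t ℤ.* c
      by-cases (yes refl) = trans
        (sum-cong-≗ λ p → cong (λ m → f (t , p) ℤ.+ + m ℤ.* c)
          (indicator-⇔ (cong proj₂) (cong (u ,_)) ((u , q) ≟ˢ (t , p)) (q Fin.≟ p)))
        (trans (sum-update (λ p → f (t , p)) q c) (cong (λ z → sum (λ p → f (t , p)) ℤ.+ z) (sym (ℤ.*-identityˡ c))))
      by-cases (no u≢t) = trans
        (sum-cong-≗ λ p → trans
          (cong (λ m → f (t , p) ℤ.+ + m ℤ.* c) (indicator-false ((u , q) ≟ˢ (t , p)) (u≢t ∘ cong proj₁)))
          (ℤ.+-identityʳ (f (t , p))))
        (sym (ℤ.+-identityʳ _))

  -- No two sides of one triangle are glued. Hence `Clockwise` has at most one witness p, and its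
  -- truth value is a count of arrows.
  edge-position : ∀ t {p q} → edge (t , p) ≡ edge (t , q) → p ≡ q
  edge-position t {p} {q} e with p Fin.≟ q
  ... | yes p≡q = p≡q
  ... | no p≢q  = contradiction (edge-injective e) λ where
    (inj₁ e′) → p≢q (sym (cong proj₂ e′))
    (inj₂ e′) → no-self-folded t p≢q (sym e′)

  arrowAt : Side N → Fin n → Fin n → ℤ
  arrowAt s i j = + (meets s i * meets (nextSide s) j)

  -- Both directions in one triangle would force `next (next p)` to be p. The nested cases of
  -- `triangleMatrix` are thus a difference of two counts.
  clockwise-excludes : ∀ {t i j} → Clockwise Γ t i j → ¬ Clockwise Γ t j i
  clockwise-excludes {t} (p , refl , refl) (q , e , e′) with edge-position t e
  ... | refl = next²≢ p (edge-position t e′)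

  sum-arrowAt-yes : ∀ {t i j} → Clockwise Γ t i j → sum (λ p → arrowAt (t , p) i j) ≡ 1ℤ
  sum-arrowAt-yes {t} {i} {j} (p , refl , refl) = trans (sum-cong-≗ only-p) (sum-point p 1ℤ)
    where
    only-p : ∀ q → arrowAt (t , q) i j ≡ + indicator (p Fin.≟ q) ℤ.* 1ℤ
    only-p q = by-cases (p Fin.≟ q)
      where
      by-cases : (p≟q : Dec (p ≡ q)) → arrowAt (t , q) i j ≡ + indicator p≟q ℤ.* 1ℤ
      by-cases (yes refl) = cong₂ (λ a b → + (a * b)) (indicator-true (edge (t , p) Fin.≟ i) refl)
        (indicator-true (edge (t , next p) Fin.≟ j) refl)
      by-cases (no p≢q) = cong (λ a → + (a * meets (t , next q) j))
        (indicator-false (edge (t , q) Fin.≟ i) λ e → p≢q (sym (edge-position t e)))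

  sum-arrowAt-no : ∀ {t i j} → ¬ Clockwise Γ t i j → sum (λ p → arrowAt (t , p) i j) ≡ 0ℤ
  sum-arrowAt-no {t} {i} {j} ¬c = sum-cong-≗ none
    where
    none : ∀ p → arrowAt (t , p) i j ≡ 0ℤ
    none p with edge (t , p) Fin.≟ i | edge (t , next p) Fin.≟ j
    ... | yes e | yes e′ = contradiction (p , e , e′) ¬c
    ... | yes _ | no _   = refl
    ... | no _  | _      = refl

  triangleMatrix-sum : ∀ t i j →
    triangleMatrix Γ t i j ≡ sum (λ p → arrowAt (t , p) i j ℤ.+ - arrowAt (t , p) j i)
  triangleMatrix-sum t i j = trans (entry (clockwise? Γ t i j) (clockwise? Γ t j i)) (trans
    (cong (λ z → sum (λ p → arrowAt (t , p) i j) ℤ.+ z) (negate (arrowAt (t , 0F) j i) (arrowAt (t , 1F) j i) (arrowAt (t , 2F) j i)))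
    (sym (∑-distrib-+ (λ p → arrowAt (t , p) i j) (λ p → - arrowAt (t , p) j i))))
    where
    negate : ∀ x y z → - (x ℤ.+ (y ℤ.+ (z ℤ.+ 0ℤ))) ≡ - x ℤ.+ (- y ℤ.+ (- z ℤ.+ 0ℤ))
    negate = ℤ.solve-∀

    entry : (c? : Dec (Clockwise Γ t i j)) (c′? : Dec (Clockwise Γ t j i)) →
      (if does c? then 1ℤ else if does c′? then -1ℤ else 0ℤ) ≡
      sum (λ p → arrowAt (t , p) i j) - sum (λ p → arrowAt (t , p) j i)
    entry (yes c) _        = sym (cong₂ _-_ (sum-arrowAt-yes c) (sum-arrowAt-no (clockwise-excludes c)))
    entry (no ¬c) (yes c′) = sym (cong₂ _-_ (sum-arrowAt-no ¬c) (sum-arrowAt-yes c′))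
    entry (no ¬c) (no ¬c′) = sym (cong₂ _-_ (sum-arrowAt-no ¬c) (sum-arrowAt-no ¬c′))

  -- One matrix sums over triangles, the other over the sides of an edge. By `incidence`, the arrows
  -- from i are supported on the two sides of i and those from j on the two sides of j, so four
  -- terms survive.
  adjacency-exchange : ∀ i j →
    adjacencyMatrix Γ i j ≡ exchange triangulation₀ i j
  adjacency-exchange i j = begin
    adjacencyMatrix Γ i j
      ≡⟨ sum-cong-≗ (λ t → triangleMatrix-sum t i j) ⟩
    sumSides (λ s → arrowAt s i j ℤ.+ - arrowAt s j i)
      ≡⟨ sum-cong-≗ (λ t → sum-cong-≗ λ p → arrows-at (t , p)) ⟩
    sumSides (add (glue (side j)) (- c₄) f₃)
      ≡⟨ sum-add (glue (side j)) (- c₄) f₃ (sum-add (side j) (- c₃) f₂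
           (sum-add (glue (side i)) c₂ f₁ (sum-add (side i) c₁ (λ _ → 0ℤ) (sum-replicate-zero N)))) ⟩
    (((0ℤ ℤ.+ c₁) ℤ.+ c₂) ℤ.+ - c₃) ℤ.+ - c₄
      ≡⟨ collect c₁ c₂ c₃ c₄ ⟩
    (c₁ ℤ.+ c₂) - (c₃ ℤ.+ c₄) ∎
    where
    open ≡-Reasoning

    δ : Side N → Side N → ℕ
    δ s s′ = indicator (s ≟ˢ s′)

    c₁ c₂ c₃ c₄ : ℤ
    c₁ = + meets (nextSide (side i)) j
    c₂ = + meets (nextSide (glue (side i))) j
    c₃ = + meets (nextSide (side j)) i
    c₄ = + meets (nextSide (glue (side j))) i

    add : Side N → ℤ → (Side N → ℤ) → Side N → ℤ
    add x c f s = f s ℤ.+ + δ x s ℤ.* c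

    f₁ f₂ f₃ : Side N → ℤ
    f₁ = add (side i) c₁ λ _ → 0ℤ
    f₂ = add (glue (side i)) c₂ f₁
    f₃ = add (side j) (- c₃) f₂

    sum-add : ∀ x c f {z} → sumSides f ≡ z → sumSides (add x c f) ≡ z ℤ.+ c
    sum-add x c f e = trans (sumSides-update f x c) (cong (ℤ._+ c) e)

    evaluate : ∀ x s j → δ x s * meets (nextSide s) j ≡ δ x s * meets (nextSide x) j
    evaluate x s j with x ≟ˢ s
    ... | yes refl = refl
    ... | no _     = refl

    arrowAt-sides : ∀ s i j → arrowAt s i j ≡
      + δ (side i) s ℤ.* + meets (nextSide (side i)) j ℤ.+ + δ (glue (side i)) s ℤ.* + meets (nextSide (glue (side i))) j
    arrowAt-sides s i j = begin
      + (meets s i * meets (nextSide s) j)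
        ≡⟨ cong (λ m → + (m * meets (nextSide s) j)) (incidence i s) ⟨
      + ((δ (side i) s + δ (glue (side i)) s) * meets (nextSide s) j)
        ≡⟨ cong +_ (*-distribʳ-+ (meets (nextSide s) j) (δ (side i) s) _) ⟩
      + (δ (side i) s * meets (nextSide s) j + δ (glue (side i)) s * meets (nextSide s) j)
        ≡⟨ cong +_ (cong₂ _+_ (evaluate (side i) s j) (evaluate (glue (side i)) s j)) ⟩
      + (δ (side i) s * meets (nextSide (side i)) j) ℤ.+ + (δ (glue (side i)) s * meets (nextSide (glue (side i))) j)
        ≡⟨ cong₂ ℤ._+_ (ℤ.pos-* (δ (side i) s) _) (ℤ.pos-* (δ (glue (side i)) s) _) ⟩
      _ ∎

    arrows-at : ∀ s → arrowAt s i j ℤ.+ - arrowAt s j i ≡ add (glue (side j)) (- c₄) f₃ s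
    arrows-at s = trans (cong₂ (λ x y → x ℤ.+ - y) (arrowAt-sides s i j) (arrowAt-sides s j i))
      (distribute (+ δ (side i) s) (+ δ (glue (side i)) s) (+ δ (side j) s) (+ δ (glue (side j)) s) c₁ c₂ c₃ c₄)
      where
      distribute : ∀ p q r s a b c d → (p ℤ.* a ℤ.+ q ℤ.* b) ℤ.+ - (r ℤ.* c ℤ.+ s ℤ.* d) ≡
        (((0ℤ ℤ.+ p ℤ.* a) ℤ.+ q ℤ.* b) ℤ.+ r ℤ.* - c) ℤ.+ s ℤ.* - d
      distribute = ℤ.solve-∀

    collect : ∀ a b c d → (((0ℤ ℤ.+ a) ℤ.+ b) ℤ.+ - c) ℤ.+ - d ≡ (a ℤ.+ b) - (c ℤ.+ d)
    collect = ℤ.solve-∀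

  balanced-initial : Balanced (adjacencyMatrix Γ , var)
  balanced-initial = record
    { triangulation = triangulation₀
    ; matrix        = adjacency-exchange
    ; sum-c-vectors = λ l → trans (sum-cong-≗ (var-indicator l)) (sum-point l 1ℤ)
    }
    where
    var-indicator : ∀ l i → var i l ≡ + indicator (l Fin.≟ i) ℤ.* 1ℤ
    var-indicator l i with does (l Fin.≟ i)
    ... | true  = refl
    ... | false = refl

  -- Absence of reddening sequences

  not-reddening : (γ : MutationSequence (adjacencyMatrix Γ)) → ¬ Reddening γ
  not-reddening γ red = contradiction (subst (ℤ._≤ 0ℤ) (sum-c-vectors l) (sum-nonpositive _ (red l)))
    λ { (ℤ.+≤+ ()) }
    where
    open MutationSequence γ
    open Balanced (balanced-seedAfter m σ balanced-initial (fromℕ T))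
    l : Fin n
    -- Row l of the final C-matrix has sum 1, which non-positive entries cannot have; the side
    -- supplied by `OncePunctured` ensures that there is a row.
    l = edge (proj₁ once-punctured)

theorem1p3 : ∀ {n : ℕ} (Γ : IdealTriangulation n) → OncePunctured Γ →
    ∀ (γ : MutationSequence (adjacencyMatrix Γ)) → ¬ Reddening γ × ¬ MaximalGreen γ
theorem1p3 Γ once-punctured γ = not-reddening Γ once-punctured γ , not-reddening Γ once-punctured γ ∘ proj₁
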